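{- For $n\ge 1$, $$(\mathfrak C_0+\mathfrak C_0+\mathfrak C_0)^n=(2n-1)(n-1)\mathfrak C_{2n}+n(2n-1)(2n-3)^2\mathfrak C_{2n-2}.$$
   Context: The numbers $\mathfrak C_{2n}$ (Cauchy numbers with level $2$) are defined by $\frac{t}{{\rm arcsinh}\,t}=\sum_{n=0}^\infty\mathfrak C_{2n}\frac{t^{2n}}{(2n)!}$. Convolution notation: $(\mathfrak C_{2j_1}+\cdots+\mathfrak C_{2j_k})^n:=\sum_{i_1+\cdots+i_k=n,\ i_1,\dots,i_k\ge0}\frac{(2n)!}{(2i_1)!\cdots(2i_k)!}\mathfrak C_{2i_1+2j_1}\cdots\mathfrak C_{2i_k+2j_k}$. -}

module Defs where

open import Data.Nat.Base as ℕ using (ℕ; zero; suc; _∸_; _!; _≤_; z≤n; s≤s)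
open import Data.Nat.DivMod using (_%_)
open import Data.Nat.GeneralisedArithmetic using (fold)
import Data.Nat.Properties as ℕₚ
open import Data.Integer.Base using (+_)
open import Data.Fin.Base using (Fin; zero; suc; toℕ)
open import Data.Fin.Properties using (toℕ≤pred[n])
open import Data.List.Base as List using (List; []; _∷_)
open import Data.Vec.Base as Vec using (Vec; []; _∷_)
open import Data.Rational.Base using (ℚ; 0ℚ; 1ℚ; _+_; _*_; _-_; -_; _/_)
open import Data.Rational.Literals using (fromℤ)
open import Data.Rational.Properties
  using (+-0-commutativeMonoid; *-zeroˡ; *-zeroʳ; *-identityˡ; +-identityˡ; +-identityʳ)
open import Data.Rational.Solver using (module +-*-Solver)
open import Algebra.Properties.CommutativeMonoid.Sum +-0-commutativeMonoid
  using (sum⁺-syntax; sum-syntax; sum-cong-≗; sum-replicate-zero)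
open import Data.Sum.Base using (inj₁; inj₂)
open import Relation.Binary.PropositionalEquality

fromℕ : ℕ → ℚ
fromℕ n = fromℤ (+ n)

1/_! : ℕ → ℚ
1/ n ! = (+ 1 / n !) {{n ℕₚ.!≢0}}

------------------------------------------------------------------------
-- Formal power series over ℚ; F n is the coefficient of tⁿ.

Series : Set
Series = ℕ → ℚ

one t : Series
one zero          = 1ℚ
one (suc _)       = 0ℚ
t zero            = 0ℚ
t (suc n)         = one n

infixl 6 _⊖_
infixl 7 _⊛_
infixr 8 _^_
infixr 9 _⊚_

_⊖_ _⊛_ : Series → Series → Series
(F ⊖ G) n = F n - G n
(F ⊛ G) n = ∑[ i ≤ n ] (F (toℕ i) * G (n ∸ toℕ i))

_^_ : Series → ℕ → Series
F ^ zero  = one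
F ^ suc k = F ^ k ⊛ F

-- Composition F(A(t)).  It is only meaningful when A 0 ≡ 0ℚ, in which case
-- Aᵏ has no terms of degree below k and the sum may be cut off at k ≤ n.
_⊚_ : Series → Series → Series
(F ⊚ A) n = ∑[ k ≤ n ] (F (toℕ k) * (A ^ toℕ k) n)

-- The t-adic limit of F, Φ F, Φ (Φ F), …, when each application of Φ
-- settles at least one further coefficient.
limit : (Series → Series) → Series → Series
limit Φ F n = fold F Φ n n

-- 1 / G for G 0 ≡ 1ℚ: the solution of H = 1 - (G - 1) H.
reciprocal : Series → Series
reciprocal G = limit (λ H → one ⊖ (G ⊖ one) ⊛ H) one

-- The compositional inverse of F, for F 0 ≡ 0ℚ and F 1 ≡ 1ℚ: the solution
-- of A = t - (F - t) ∘ A.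
reversion : Series → Series
reversion F = limit (λ A → t ⊖ (F ⊖ t) ⊚ A) t

sinh arcsinh : Series
sinh n  = fromℕ (n % 2) * 1/ n !
arcsinh = reversion sinh

-- Numerator and denominator both start in degree 1, so a factor t is
-- cancelled before dividing.
t/arcsinh : Series
t/arcsinh = reciprocal (λ n → arcsinh (suc n))

------------------------------------------------------------------------
-- Cauchy numbers with level 2

-- t / arcsinh t = Σₘ ℭ m tᵐ / m!.  As t / arcsinh t is even, only the
-- numbers ℭ (2 * n) matter.
ℭ : ℕ → ℚ
ℭ m = fromℕ (m !) * t/arcsinh m

-- All (i₁ , … , iₖ) with i₁ + ⋯ + iₖ = n, each listed once.
weakCompositions : ∀ k → ℕ → List (Vec ℕ k)
weakCompositions zero    zero    = [] ∷ []
weakCompositions zero    (suc _) = []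
weakCompositions (suc k) n       =
  List.concatMap (λ i → List.map (i ∷_) (weakCompositions k (n ∸ i)))
                 (List.upTo (suc n))

∏ : ∀ {k} → Vec ℚ k → ℚ
∏ = Vec.foldr′ _*_ 1ℚ

-- convolution (j₁ ∷ … ∷ jₖ ∷ []) n is (ℭ_{2j₁} + ⋯ + ℭ_{2jₖ})ⁿ.
convolution : ∀ {k} → Vec ℕ k → ℕ → ℚ
convolution {k} js n =
  List.foldr _+_ 0ℚ (List.map term (weakCompositions k n))
  where
  term : Vec ℕ k → ℚ
  term is = fromℕ ((2 ℕ.* n) !) * ∏ (Vec.map (λ i → 1/ (2 ℕ.* i) !) is)
          * ∏ (Vec.zipWith (λ i j → ℭ (2 ℕ.* i ℕ.+ 2 ℕ.* j)) is js)

------------------------------------------------------------------------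
-- The limits above exist and solve their equations; in particular
-- sinh ⊚ arcsinh ≗ t and arcsinh ⊛ t/arcsinh ≗ t.

Agree : ℕ → Series → Series → Set
Agree n F G = ∀ m → m ≤ n → F m ≡ G m

Contracting : (Series → Series) → Series → Set
Contracting Φ F = ∀ n {G H} → G 0 ≡ F 0 → H 0 ≡ F 0 →
                  Agree n G H → Agree (suc n) (Φ G) (Φ H)

module _ {Φ : Series → Series} {F : Series}
         (contr : Contracting Φ F) (base : Φ F 0 ≡ F 0) where

  private
    it : ℕ → Series
    it = fold F Φ

    it-0 : ∀ n → it n 0 ≡ F 0
    it-0 zero    = refl
    it-0 (suc n) =
      trans (contr 0 (it-0 n) refl (λ { _ z≤n → it-0 n }) 0 z≤n) base

    it-step : ∀ n → Agree n (it n) (it (suc n))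
    it-step zero    _ z≤n = sym base
    it-step (suc n) = contr n (it-0 n) (it-0 (suc n)) (it-step n)

    it-stable : ∀ n → Agree n (limit Φ F) (it n)
    it-stable zero    _ z≤n = refl
    it-stable (suc n) m m≤1+n with ℕₚ.m≤n⇒m<n∨m≡n m≤1+n
    ... | inj₁ (s≤s m≤n) = trans (it-stable n m m≤n) (it-step n m m≤n)
    ... | inj₂ refl      = refl

  limit-fixed : limit Φ F ≗ Φ (limit Φ F)
  limit-fixed n = trans (it-step n n ℕₚ.≤-refl)
    (sym (contr n refl (it-0 n) (it-stable n) n (ℕₚ.n≤1+n n)))

private
  0*x≡0*y : ∀ {a} x y → a ≡ 0ℚ → a * x ≡ a * y
  0*x≡0*y x y refl = trans (*-zeroˡ x) (sym (*-zeroˡ y))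

  -- If h = a - (b - h) then b = a.
  rearrange : ∀ {h a b} → h ≡ a - (b - h) → b ≡ a
  rearrange {h} {a} {b} eq =
    trans (solve 2 (λ b h → b := h :+ (b :- h)) refl b h)
   (trans (cong (_+ (b - h)) eq)
          (solve 3 (λ a b h → (a :- (b :- h)) :+ (b :- h) := a) refl a b h))
    where open +-*-Solver

  sum-⊖ : ∀ n (a b c : Fin n → ℚ) →
          ∑[ i < n ] ((a i - b i) * c i) ≡
          ∑[ i < n ] (a i * c i) - ∑[ i < n ] (b i * c i)
  sum-⊖ zero    a b c = refl
  sum-⊖ (suc n) a b c =
    trans (cong (_+_ ((a zero - b zero) * c zero))
            (sum-⊖ n (λ i → a (suc i)) (λ i → b (suc i)) (λ i → c (suc i))))
          (solve 5 (λ x y z u v → (x :- y) :* z :+ (u :- v) :=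
                                  (x :* z :+ u) :- (y :* z :+ v))
             refl (a zero) (b zero) (c zero) _ _)
    where open +-*-Solver

  sum-0* : ∀ n (c : Fin n → ℚ) → ∑[ i < n ] (0ℚ * c i) ≡ 0ℚ
  sum-0* n c = trans (sum-cong-≗ {n} (λ i → *-zeroˡ (c i))) (sum-replicate-zero n)

  1*x+sum-0* : ∀ n x (c : Fin n → ℚ) → 1ℚ * x + ∑[ i < n ] (0ℚ * c i) ≡ x
  1*x+sum-0* n x c =
    trans (cong₂ _+_ (*-identityˡ x) (sum-0* n c)) (+-identityʳ x)

  0*x+y≡y : ∀ x y → 0ℚ * x + y ≡ y
  0*x+y≡y x y = trans (cong (_+ y) (*-zeroˡ x)) (+-identityˡ y)

  ⊛-identityˡ : ∀ F → one ⊛ F ≗ F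
  ⊛-identityˡ F n = 1*x+sum-0* n (F n) (λ i → F (n ∸ suc (toℕ i)))

  t⊚ : ∀ {A} → A 0 ≡ 0ℚ → t ⊚ A ≗ A
  t⊚     A0 zero    = sym A0
  t⊚ {A} A0 (suc n) =
    trans (0*x+y≡y (one (suc n)) _)
   (trans (1*x+sum-0* n ((A ^ 1) (suc n)) (λ k → (A ^ suc (suc (toℕ k))) (suc n)))
          (⊛-identityˡ A (suc n)))

  ^-0 : ∀ {A} k → A 0 ≡ 0ℚ → (A ^ suc k) 0 ≡ 0ℚ
  ^-0 {A} k A0 = trans (+-identityʳ _)
    (trans (cong ((A ^ k) 0 *_) A0) (*-zeroʳ ((A ^ k) 0)))

  ⊛-agree : ∀ n {P Q A B} → Agree n P Q → Agree n A B → Agree n (P ⊛ A) (Q ⊛ B)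
  ⊛-agree n p a m m≤n = sum-cong-≗ {suc m} (λ i → cong₂ _*_
    (p _ (ℕₚ.≤-trans (toℕ≤pred[n] i) m≤n))
    (a _ (ℕₚ.≤-trans (ℕₚ.m∸n≤m m (toℕ i)) m≤n)))

  ^-agree : ∀ n {A B} k → Agree n A B → Agree n (A ^ k) (B ^ k)
  ^-agree n zero    a _ _ = refl
  ^-agree n (suc k) a = ⊛-agree n (^-agree n k a) a

  ⊛-agree⁺ : ∀ n {P Q A B} → P 0 ≡ 0ℚ → Q 0 ≡ 0ℚ → A 0 ≡ 0ℚ → B 0 ≡ 0ℚ →
             Agree n P Q → Agree n A B → Agree (suc n) (P ⊛ A) (Q ⊛ B)
  ⊛-agree⁺ n {P} {Q} {A} {B} P0 Q0 A0 B0 p a m m≤1+n =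
    sum-cong-≗ {suc m} (λ i → eq (toℕ i) (toℕ≤pred[n] i))
    where
    vanish : ∀ {x y} u v → x ≡ 0ℚ → y ≡ 0ℚ → x * u ≡ y * v
    vanish u v refl refl = 0*x≡0*y u v refl
    vanishʳ : ∀ {x y} u v → x ≡ 0ℚ → y ≡ 0ℚ → u * x ≡ v * y
    vanishʳ u v refl refl = trans (*-zeroʳ u) (sym (*-zeroʳ v))
    eq : ∀ i → i ≤ m → P i * A (m ∸ i) ≡ Q i * B (m ∸ i)
    eq zero    _   = vanish _ _ P0 Q0
    eq (suc i) i<m with ℕₚ.m≤n⇒m<n∨m≡n i<m
    ... | inj₂ refl rewrite ℕₚ.n∸n≡0 i = vanishʳ (P (suc i)) (Q (suc i)) A0 B0
    ... | inj₁ i+1<m = cong₂ _*_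
      (p _ (ℕₚ.≤-pred (ℕₚ.≤-trans i+1<m m≤1+n)))
      (a _ (ℕₚ.∸-mono m≤1+n (s≤s (z≤n {i}))))

reciprocal-correct : ∀ G → G 0 ≡ 1ℚ → G ⊛ reciprocal G ≗ one
reciprocal-correct G G0 n = rearrange
  (trans (limit-fixed contr base n) (cong (_-_ (one n))
    (trans (sum-⊖ (suc n) (λ i → G (toℕ i)) (λ i → one (toℕ i))
                  (λ i → R (n ∸ toℕ i)))
           (cong (_-_ ((G ⊛ R) n)) (⊛-identityˡ R n)))))
  where
  R = reciprocal G
  Φ : Series → Series
  Φ H = one ⊖ (G ⊖ one) ⊛ H
  d0 : (G ⊖ one) 0 ≡ 0ℚ
  d0 rewrite G0 = refl
  base : Φ one 0 ≡ one 0
  base rewrite G0 = refl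
  contr : Contracting Φ one
  contr n {H} {K} _ _ h m m≤1+n = cong (_-_ (one m)) (sum-cong-≗ {suc m} eq)
    where
    eq : ∀ i → (G ⊖ one) (toℕ i) * H (m ∸ toℕ i) ≡
               (G ⊖ one) (toℕ i) * K (m ∸ toℕ i)
    eq zero    = 0*x≡0*y _ _ d0
    eq (suc i) = cong ((G ⊖ one) (suc (toℕ i)) *_)
      (h _ (ℕₚ.∸-mono m≤1+n (s≤s (z≤n {toℕ i}))))

module _ (F : Series) (F0 : F 0 ≡ 0ℚ) (F1 : F 1 ≡ 1ℚ) where
  private
    Φ : Series → Series
    Φ A = t ⊖ (F ⊖ t) ⊚ A
    d0 : (F ⊖ t) 0 ≡ 0ℚ
    d0 rewrite F0 = refl
    d1 : (F ⊖ t) 1 ≡ 0ℚ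
    d1 rewrite F1 = refl
    base : Φ t 0 ≡ t 0
    base rewrite F0 = refl
    contr : Contracting Φ t
    contr n {A} {B} A0 B0 a m m≤1+n =
      cong (_-_ (t m)) (sum-cong-≗ {suc m} (λ k → eq (toℕ k)))
      where
      eq : ∀ k → (F ⊖ t) k * (A ^ k) m ≡ (F ⊖ t) k * (B ^ k) m
      eq zero          = refl
      eq (suc zero)    = 0*x≡0*y _ _ d1
      eq (suc (suc k)) = cong ((F ⊖ t) (suc (suc k)) *_)
        (⊛-agree⁺ n {A ^ suc k} {B ^ suc k} {A} {B} (^-0 {A} k A0) (^-0 {B} k B0)
          A0 B0 (^-agree n (suc k) a) a m m≤1+n)

  reversion-correct : F ⊚ reversion F ≗ t
  reversion-correct n = rearrange
    (trans (limit-fixed contr base n) (cong (_-_ (t n))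
      (trans (sum-⊖ (suc n) (λ k → F (toℕ k)) (λ k → t (toℕ k))
                    (λ k → (reversion F ^ toℕ k) n))
             (cong (_-_ ((F ⊚ reversion F) n)) (t⊚ {reversion F} refl n)))))

sinh⊚arcsinh : sinh ⊚ arcsinh ≗ t
sinh⊚arcsinh = reversion-correct sinh refl refl

arcsinh⊛t/arcsinh : arcsinh ⊛ t/arcsinh ≗ t
arcsinh⊛t/arcsinh zero    = refl
arcsinh⊛t/arcsinh (suc n) =
  trans (0*x+y≡y (t/arcsinh (suc n)) _)
        (reciprocal-correct (λ k → arcsinh (suc k)) refl n)

{-# OPTIONS --safe #-}
module Submission where

-- Write A = arcsinh t, f = t / A, and θ = t d/dt, a derivation of the ring of
-- power series.  The chain rule applied to sinh ∘ A = t gives C · θA = t and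
-- θC = t · θA for C = cosh ∘ A, so θ(C²) = 2t² and C² = 1 + t²; eliminating C
-- yields (1 + t²) θ²A = θA.  From fA = t one gets t (θ − 1)f = − f² θA, and a
-- further differentiation leads to
--   (θ − 2)(θ − 1)f + t² (θ − 1)²f = 2f³,
-- whose coefficient in degree 2n is the assertion, f being an even series.

open import Defs
open import Algebra.Bundles using (CommutativeRing)
import Algebra.Construct.Pointwise as Pointwise
import Algebra.Solver.Ring as RingSolver
open import Algebra.Solver.Ring.AlmostCommutativeRing
  using (fromCommutativeRing; _-Raw-AlmostCommutative⟶_)
open import Data.Fin.Base using (Fin; zero; suc; toℕ)
open import Data.Fin.Properties using (toℕ≤pred[n])
import Data.Integer.Base as ℤ
import Data.Integer.Properties as ℤₚ
open import Data.List.Base as List using (List; []; _∷_; _++_)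
import Data.List.Properties as Listₚ
import Data.Maybe.Base as Maybe
open import Data.Nat.Base as ℕ
  using (ℕ; zero; suc; _≥_; _∸_; _≤_; _<_; z≤n; s≤s; _!)
import Data.Nat.Properties as ℕₚ
open import Data.Product.Base using (_,_)
open import Data.Rational.Base
  using (ℚ; 0ℚ; 1ℚ; _+_; _*_; _-_; -_; _/_)
open import Data.Rational.Properties
open import Data.Rational.Solver using (module +-*-Solver)
import Data.Rational.Unnormalised.Base as ℚᵘ
import Data.Rational.Unnormalised.Properties as ℚᵘₚ
open import Data.Vec.Base as Vec using (Vec; []; _∷_)
open import Function.Base using (_∘_)
open import Level using (0ℓ)
open import Relation.Binary.PropositionalEquality
open import Relation.Nullary.Decidable.Core using (dec⇒maybe)
open import Algebra.Properties.CommutativeMonoid.Sum +-0-commutativeMonoid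
  using (sum; sum⁺-syntax; sum-syntax; sum-cong-≗; sum-replicate-zero; ∑-distrib-+)
open import Algebra.Properties.Semiring.Sum (CommutativeRing.semiring +-*-commutativeRing)
  using (*-distribˡ-sum)

-- The ring of power series

infixl 6 _⊕_
infix 8 ⊝_

𝟎 : Series
𝟎 _ = 0ℚ

_⊕_ : Series → Series → Series
(F ⊕ G) n = F n + G n

⊝_ : Series → Series
(⊝ F) n = - F n

const : ℚ → Series
const c zero    = c
const c (suc _) = 0ℚ

tail : Series → Series
tail F = F ∘ suc

⊛-cong : ∀ {F G H K} → F ≗ G → H ≗ K → F ⊛ H ≗ G ⊛ K
⊛-cong F≗G H≗K n = sum-cong-≗ {suc n} (λ i → cong₂ _*_ (F≗G (toℕ i)) (H≗K (n ∸ toℕ i)))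

⊛-vanishˡ : ∀ {F} G n → (∀ i → i ≤ n → F i ≡ 0ℚ) → (F ⊛ G) n ≡ 0ℚ
⊛-vanishˡ G n F≡0 =
  trans (sum-cong-≗ {suc n} (λ i →
          trans (cong (_* G (n ∸ toℕ i)) (F≡0 (toℕ i) (toℕ≤pred[n] i))) (*-zeroˡ (G (n ∸ toℕ i)))))
        (sum-replicate-zero (suc n))

-- By definition the first term of the convolution splits off, which shortens the left factor.
-- Splitting off the last term gives the mirror recursion, and the two together make commutativity
-- an induction on the degree.
⊛-sucʳ : ∀ F G n → (F ⊛ G) (suc n) ≡ (F ⊛ tail G) n + F (suc n) * G 0
⊛-sucʳ F G zero =
  solve 2 (λ x y → x :+ (y :+ con 0ℚ) := (x :+ con 0ℚ) :+ y) refl (F 0 * G 1) (F 1 * G 0)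
  where open +-*-Solver
⊛-sucʳ F G (suc n) =
  trans (cong (F 0 * G (suc (suc n)) +_) (⊛-sucʳ (tail F) G n))
        (sym (+-assoc (F 0 * G (suc (suc n))) _ _))

⊛-comm : ∀ F G → F ⊛ G ≗ G ⊛ F
⊛-comm F G zero    = cong (_+ 0ℚ) (*-comm (F 0) (G 0))
⊛-comm F G (suc n) = trans
  (trans (+-comm (F 0 * G (suc n)) _)
         (cong₂ _+_ (⊛-comm (tail F) G n) (*-comm (F 0) (G (suc n)))))
  (sym (⊛-sucʳ G F n))

⊛-distribʳ-⊕ : ∀ H F G → (F ⊕ G) ⊛ H ≗ F ⊛ H ⊕ G ⊛ H
⊛-distribʳ-⊕ H F G n = trans
  (sum-cong-≗ {suc n} (λ i → *-distribʳ-+ (H (n ∸ toℕ i)) (F (toℕ i)) (G (toℕ i))))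
  (∑-distrib-+ {suc n} (λ i → F (toℕ i) * H (n ∸ toℕ i)) (λ i → G (toℕ i) * H (n ∸ toℕ i)))

⊛-distribˡ-⊕ : ∀ H F G → H ⊛ (F ⊕ G) ≗ H ⊛ F ⊕ H ⊛ G
⊛-distribˡ-⊕ H F G n = trans (⊛-comm H (F ⊕ G) n)
  (trans (⊛-distribʳ-⊕ H F G n) (cong₂ _+_ (⊛-comm F H n) (⊛-comm G H n)))

const-⊛ : ∀ c F n → (const c ⊛ F) n ≡ c * F n
const-⊛ c F zero    = +-identityʳ (c * F 0)
const-⊛ c F (suc n) = trans
  (cong (c * F (suc n) +_) (⊛-vanishˡ F n (λ _ _ → refl)))
  (+-identityʳ (c * F (suc n)))

scale-⊛ : ∀ c F G n → ((λ i → c * F i) ⊛ G) n ≡ c * (F ⊛ G) n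
scale-⊛ c F G zero = solve 3 (λ c x y → c :* x :* y :+ con 0ℚ := c :* (x :* y :+ con 0ℚ))
  refl c (F 0) (G 0)
  where open +-*-Solver
scale-⊛ c F G (suc n) = trans
  (cong (c * F 0 * G (suc n) +_) (scale-⊛ c (tail F) G n))
  (solve 4 (λ c x y z → c :* x :* y :+ c :* z := c :* (x :* y :+ z)) refl
    c (F 0) (G (suc n)) ((tail F ⊛ G) n))
  where open +-*-Solver

⊛-assoc : ∀ F G H → (F ⊛ G) ⊛ H ≗ F ⊛ (G ⊛ H)
⊛-assoc F G H zero =
  solve 3 (λ x y z → (x :* y :+ con 0ℚ) :* z :+ con 0ℚ := x :* (y :* z :+ con 0ℚ) :+ con 0ℚ)
    refl (F 0) (G 0) (H 0)
  where open +-*-Solver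
⊛-assoc F G H (suc n) = begin
  (x * y + 0ℚ) * z + (tail (F ⊛ G) ⊛ H) n
    -- By computation `tail (F ⊛ G)` is `x` times `tail G` plus `tail F ⊛ G`, so the induction
    -- hypothesis is used for `tail F`.
    ≡⟨ cong ((x * y + 0ℚ) * z +_) (trans
         (⊛-distribʳ-⊕ H (λ i → x * tail G i) (tail F ⊛ G) n)
         (cong₂ _+_ (scale-⊛ x (tail G) H n) (⊛-assoc (tail F) G H n))) ⟩
  (x * y + 0ℚ) * z + (x * (tail G ⊛ H) n + (tail F ⊛ (G ⊛ H)) n)
    ≡⟨ solve 5 (λ x y z u v → (x :* y :+ con 0ℚ) :* z :+ (x :* u :+ v)
                              := x :* (y :* z :+ u) :+ v)
         refl x y z ((tail G ⊛ H) n) ((tail F ⊛ (G ⊛ H)) n) ⟩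
  x * (y * z + (tail G ⊛ H) n) + (tail F ⊛ (G ⊛ H)) n ∎
  where
  open ≡-Reasoning
  open +-*-Solver
  x = F 0
  y = G 0
  z = H (suc n)

one-⊛ : ∀ F → one ⊛ F ≗ F
one-⊛ F n = trans (⊛-cong {one} {const 1ℚ} {F} {F} one≗const (λ _ → refl) n)
                  (trans (const-⊛ 1ℚ F n) (*-identityˡ (F n)))
  where
  one≗const : one ≗ const 1ℚ
  one≗const zero    = refl
  one≗const (suc _) = refl

seriesRing : CommutativeRing 0ℓ 0ℓ
seriesRing = record
  { Carrier = Series
  ; _≈_ = _≗_
  ; _+_ = _⊕_
  ; _*_ = _⊛_
  ; -_  = ⊝_
  ; 0#  = 𝟎
  ; 1#  = one
  ; isCommutativeRing = record
    { isRing = record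
      { +-isAbelianGroup = Pointwise.isAbelianGroup ℕ +-0-isAbelianGroup
      ; *-cong     = ⊛-cong
      ; *-assoc    = ⊛-assoc
      ; *-identity = one-⊛ , λ F n → trans (⊛-comm F one n) (one-⊛ F n)
      ; distrib    = ⊛-distribˡ-⊕ , ⊛-distribʳ-⊕
      }
    ; *-comm = ⊛-comm
    }
  }

-- Constant series embed ℚ into the ring of series, so that the ring solver can take rational
-- numbers as coefficients and decide their equality.
const-homo : CommutativeRing.rawRing +-*-commutativeRing
               -Raw-AlmostCommutative⟶ fromCommutativeRing seriesRing
const-homo = record
  { ⟦_⟧    = const
  ; +-homo = λ { _ _ zero → refl ; _ _ (suc _) → refl }
  ; *-homo = λ c d n → sym (trans (const-⊛ c (const d) n) (pointwise c d n))
  ; -‿homo = λ { _ zero → refl ; _ (suc _) → refl }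
  ; 0-homo = λ { zero → refl ; (suc _) → refl }
  ; 1-homo = λ { zero → refl ; (suc _) → refl }
  }
  where
  pointwise : ∀ c d n → c * const d n ≡ const (c * d) n
  pointwise c d zero    = refl
  pointwise c d (suc n) = *-zeroʳ c

module SeriesSolver = RingSolver
  (CommutativeRing.rawRing +-*-commutativeRing) (fromCommutativeRing seriesRing) const-homo
  (λ c d → Maybe.map (λ eq n → cong (λ x → const x n) eq) (dec⇒maybe (c ≟ d)))

-- An identity that follows from relations L ≗ R is proved by exhibiting the
-- difference of its sides as a combination of the differences L ⊖ R.
multiple-≗𝟎 : ∀ c F G → F ≗ G → c ⊛ (F ⊖ G) ≗ 𝟎
multiple-≗𝟎 c F G F≗G n = trans (⊛-comm c (F ⊖ G) n)
  (⊛-vanishˡ c n (λ i _ → trans (cong (_- G i) (F≗G i)) (+-inverseʳ (G i))))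

differ-by-𝟎 : ∀ F G {K} → F ≗ G ⊕ K → K ≗ 𝟎 → F ≗ G
differ-by-𝟎 F G F≗G+K K≗0 n = trans (F≗G+K n) (trans (cong (G n +_) (K≗0 n)) (+-identityʳ (G n)))

_⊕-𝟎_ : ∀ {F G} → F ≗ 𝟎 → G ≗ 𝟎 → F ⊕ G ≗ 𝟎
(F≗0 ⊕-𝟎 G≗0) n = cong₂ _+_ (F≗0 n) (G≗0 n)

-- const 1ℚ rather than one, as this is how the solver interprets its literals.
1+t² : Series
1+t² = const 1ℚ ⊕ t ⊛ t

-- Pure algebra, to be used with `C` = cosh ∘ A, `a` = θA, and primes for the images under θ; the
-- last hypothesis is then θ applied to the first. Multiplied by `C`, it becomes t² a + (1 + t²) a′
-- = C t, and C t = C² a = (1 + t²) a.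
ode : ∀ C a C′ a′ → C ⊛ a ≗ t → C ⊛ C ≗ 1+t² → C′ ≗ t ⊛ a →
      C′ ⊛ a ⊕ C ⊛ a′ ≗ t → 1+t² ⊛ a′ ≗ a
ode C a C′ a′ r₁ r₂ r₃ q = differ-by-𝟎 (1+t² ⊛ a′) a
  (solve 5 (λ C a C′ a′ t → let s = con 1ℚ :+ t :* t in
     s :* a′ := a :+ (((:- C :- t :* a) :* (C :* a :- t)
       :+ (a :- a′) :* (C :* C :- s))
       :+ ((:- (C :* a)) :* (C′ :- t :* a)
       :+ C :* (C′ :* a :+ C :* a′ :- t))))
     (λ _ → refl) C a C′ a′ t)
  ((multiple-≗𝟎 (⊝ C ⊖ t ⊛ a) (C ⊛ a) t r₁ ⊕-𝟎 multiple-≗𝟎 (a ⊖ a′) (C ⊛ C) 1+t² r₂)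
   ⊕-𝟎 (multiple-≗𝟎 (⊝ (C ⊛ a)) C′ (t ⊛ a) r₃
   ⊕-𝟎 multiple-≗𝟎 C (C′ ⊛ a ⊕ C ⊛ a′) t q))
  where open SeriesSolver

-- The second hypothesis is the product rule for A f = t. Multiplied by `f`, it loses `A`, because A
-- f f′ = t f′.
quotient-ode₁ : ∀ A a f f′ → A ⊛ f ≗ t → a ⊛ f ⊕ A ⊛ f′ ≗ t →
                t ⊛ (f′ ⊖ f) ≗ ⊝ (f ⊛ f ⊛ a)
quotient-ode₁ A a f f′ r r′ = differ-by-𝟎 (t ⊛ (f′ ⊖ f)) (⊝ (f ⊛ f ⊛ a))
  (solve 5 (λ A a f f′ t → t :* (f′ :- f) := :- (f :* f :* a) :+
       (f :* (a :* f :+ A :* f′ :- t) :+ (:- f′) :* (A :* f :- t)))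
     (λ _ → refl) A a f f′ t)
  (multiple-≗𝟎 f (a ⊛ f ⊕ A ⊛ f′) t r′ ⊕-𝟎 multiple-≗𝟎 (⊝ f′) (A ⊛ f) t r)
  where open SeriesSolver

-- Here `u` stands for (θ - 1)f, so `u ⊕ f` is θf, and the last hypothesis is θ applied to the one
-- before. It is multiplied by (1 + t²) t. Then (1 + t²) a′ = a removes `a′`, terms with f² a turn
-- into multiples of t u, and the remaining a² goes by (1 + t²) a² = (C a)² = t². The common factor
-- t² of the result is left to be cancelled by a shift of degree.
quotient-ode₂ : ∀ C a a′ f u u′ → C ⊛ a ≗ t → C ⊛ C ≗ 1+t² → 1+t² ⊛ a′ ≗ a →
  t ⊛ u ≗ ⊝ (f ⊛ f ⊛ a) →
  t ⊛ u ⊕ t ⊛ u′ ≗ ⊝ (((u ⊕ f) ⊛ f ⊕ f ⊛ (u ⊕ f)) ⊛ a ⊕ f ⊛ f ⊛ a′) →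
  t ⊛ (t ⊛ ((u′ ⊖ u ⊖ u) ⊕ t ⊛ (t ⊛ (u′ ⊖ u)))) ≗ t ⊛ (t ⊛ (f ⊛ (f ⊛ f) ⊕ f ⊛ (f ⊛ f)))
quotient-ode₂ C a a′ f u u′ r₁ r₂ r₃ r₆ r₇ =
  differ-by-𝟎 (t ⊛ (t ⊛ ((u′ ⊖ u ⊖ u) ⊕ t ⊛ (t ⊛ (u′ ⊖ u)))))
              (t ⊛ (t ⊛ (f ⊛ (f ⊛ f) ⊕ f ⊛ (f ⊛ f))))
  (solve 7 (λ C a a′ f u u′ t →
     let s = con 1ℚ :+ t :* t
         x = f :* (f :* f) :+ f :* (f :* f)
         y = f :* a :+ f :* a :+ (t :+ t) in
     t :* (t :* ((u′ :- u :- u) :+ t :* (t :* (u′ :- u)))) :=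
     t :* (t :* x) :+
     (((s :* t) :* (t :* u :+ t :* u′ :- (:- (((u :+ f) :* f :+ f :* (u :+ f)) :* a :+ f :* f :* a′)))
      :+ (:- (s :* y :+ t)) :* (t :* u :- (:- (f :* f :* a))))
     :+ ((x :* (C :* a :+ t)) :* (C :* a :- t)
      :+ ((:- (x :* (a :* a))) :* (C :* C :- s)
      :+ (:- (t :* (f :* f))) :* (s :* a′ :- a)))))
     (λ _ → refl) C a a′ f u u′ t)
  ((multiple-≗𝟎 (1+t² ⊛ t) (t ⊛ u ⊕ t ⊛ u′)
      (⊝ (((u ⊕ f) ⊛ f ⊕ f ⊛ (u ⊕ f)) ⊛ a ⊕ f ⊛ f ⊛ a′)) r₇
   ⊕-𝟎 multiple-≗𝟎 (⊝ (1+t² ⊛ y ⊕ t)) (t ⊛ u) (⊝ (f ⊛ f ⊛ a)) r₆)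
   ⊕-𝟎 (multiple-≗𝟎 (x ⊛ (C ⊛ a ⊕ t)) (C ⊛ a) t r₁
   ⊕-𝟎 (multiple-≗𝟎 (⊝ (x ⊛ (a ⊛ a))) (C ⊛ C) 1+t² r₂
   ⊕-𝟎 multiple-≗𝟎 (⊝ (t ⊛ (f ⊛ f))) (1+t² ⊛ a′) a r₃)))
  where
  open SeriesSolver
  x = f ⊛ (f ⊛ f) ⊕ f ⊛ (f ⊛ f)
  y = f ⊛ a ⊕ f ⊛ a ⊕ (t ⊕ t)

-- Factorials, derivations and the chain rule

fromℕ-+ : ∀ m n → fromℕ (m ℕ.+ n) ≡ fromℕ m + fromℕ n
fromℕ-+ m n = toℚᵘ-injective (ℚᵘₚ.≃-sym (ℚᵘₚ.≃-trans (toℚᵘ-homo-+ (fromℕ m) (fromℕ n))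
  (ℚᵘ.*≡* (cong (ℤ._* ℤ.+ 1) (cong₂ ℤ._+_ (ℤₚ.*-identityʳ (ℤ.+ m)) (ℤₚ.*-identityʳ (ℤ.+ n)))))))

fromℕ-* : ∀ m n → fromℕ (m ℕ.* n) ≡ fromℕ m * fromℕ n
fromℕ-* m n = toℚᵘ-injective (ℚᵘₚ.≃-sym (ℚᵘₚ.≃-trans (toℚᵘ-homo-* (fromℕ m) (fromℕ n))
  (ℚᵘ.*≡* (cong (ℤ._* ℤ.+ 1) (sym (ℤₚ.pos-* m n))))))

1/-inverse : ∀ m .{{_ : ℕ.NonZero m}} → ℤ.+ 1 / m * fromℕ m ≡ 1ℚ
1/-inverse (suc m) = toℚᵘ-injective (ℚᵘₚ.≃-trans (toℚᵘ-homo-* (ℤ.+ 1 / suc m) (fromℕ (suc m)))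
  (ℚᵘₚ.≃-trans (ℚᵘₚ.*-congʳ {ℚᵘ.mkℚᵘ (ℤ.+ suc m) 0} (toℚᵘ-fromℚᵘ (ℚᵘ.mkℚᵘ (ℤ.+ 1) m)))
    (ℚᵘ.*≡* (ℤₚ.*-assoc (ℤ.+ 1) (ℤ.+ suc m) (ℤ.+ 1)))))

1/!-inverse : ∀ n → 1/ n ! * fromℕ (n !) ≡ 1ℚ
1/!-inverse n = 1/-inverse (n !) {{n ℕₚ.!≢0}}

!-suc : ∀ n → fromℕ (suc n !) ≡ fromℕ (suc n) * fromℕ (n !)
!-suc n = fromℕ-* (suc n) (n !)

1/!-suc : ∀ n → fromℕ (suc n) * 1/ suc n ! ≡ 1/ n !
1/!-suc n = begin
  s * i                ≡⟨ *-identityʳ (s * i) ⟨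
  s * i * 1ℚ           ≡⟨ cong (s * i *_) (1/!-inverse n) ⟨
  s * i * (j * f)      ≡⟨ solve 4 (λ s i j f → s :* i :* (j :* f) := i :* (s :* f) :* j) refl s i j f ⟩
  i * (s * f) * j      ≡⟨ cong (λ x → i * x * j) (!-suc n) ⟨
  i * fromℕ (suc n !) * j  ≡⟨ cong (_* j) (1/!-inverse (suc n)) ⟩
  1ℚ * j               ≡⟨ *-identityˡ j ⟩
  j                    ∎
  where
  open ≡-Reasoning
  open +-*-Solver
  s = fromℕ (suc n)
  i = 1/ suc n !
  j = 1/ n !
  f = fromℕ (n !)

-- θ = t d/dt, unlike D = d/dt, preserves degrees, so that it can be pushed
-- through a convolution term by term.
D θ : Series → Series
D F n = fromℕ (suc n) * F (suc n)
θ F n = fromℕ n * F n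

D-D-sinh : D (D sinh) ≗ sinh
D-D-sinh n = begin
  fromℕ (suc n) * (fromℕ (suc (suc n)) * (p * 1/ suc (suc n) !))
    ≡⟨ solve 4 (λ x y p z → x :* (y :* (p :* z)) := p :* (x :* (y :* z))) refl
         (fromℕ (suc n)) (fromℕ (suc (suc n))) p (1/ suc (suc n) !) ⟩
  p * (fromℕ (suc n) * (fromℕ (suc (suc n)) * 1/ suc (suc n) !))
    ≡⟨ cong (λ x → p * (fromℕ (suc n) * x)) (1/!-suc (suc n)) ⟩
  p * (fromℕ (suc n) * 1/ suc n !)
    ≡⟨ cong (p *_) (1/!-suc n) ⟩
  p * 1/ n ! ∎
  where
  open ≡-Reasoning
  open +-*-Solver
  p = fromℕ (n ℕ.% 2)

θ-cong : ∀ {F G} → F ≗ G → θ F ≗ θ G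
θ-cong F≗G n = cong (fromℕ n *_) (F≗G n)

θ-⊛ : ∀ F G → θ (F ⊛ G) ≗ θ F ⊛ G ⊕ F ⊛ θ G
θ-⊛ F G n = begin
  fromℕ n * sum {suc n} s ≡⟨ *-distribˡ-sum {suc n} (fromℕ n) s ⟩
  ∑[ i ≤ n ] (fromℕ n * s i) ≡⟨ sum-cong-≗ {suc n} step ⟩
  ∑[ i ≤ n ] (l i + r i) ≡⟨ ∑-distrib-+ {suc n} l r ⟩
  (θ F ⊛ G ⊕ F ⊛ θ G) n ∎
  where
  open ≡-Reasoning
  open +-*-Solver
  s l r : Fin (suc n) → ℚ
  s i = F (toℕ i) * G (n ∸ toℕ i)
  l i = θ F (toℕ i) * G (n ∸ toℕ i)
  r i = F (toℕ i) * θ G (n ∸ toℕ i)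
  step : ∀ i → fromℕ n * s i ≡ l i + r i
  step i = trans
    (cong (_* s i) (trans (cong fromℕ (sym (ℕₚ.m+[n∸m]≡n (toℕ≤pred[n] i))))
                          (fromℕ-+ (toℕ i) (n ∸ toℕ i))))
    (solve 4 (λ x y u v → (x :+ y) :* (u :* v) := x :* u :* v :+ u :* (y :* v)) refl
      (fromℕ (toℕ i)) (fromℕ (n ∸ toℕ i)) (F (toℕ i)) (G (n ∸ toℕ i)))

θ-t : θ t ≗ t
θ-t zero          = refl
θ-t (suc zero)    = refl
θ-t (suc (suc n)) = *-zeroʳ (fromℕ (suc (suc n)))

θ-^ : ∀ A k n → θ (A ^ suc k) n ≡ fromℕ (suc k) * (A ^ k ⊛ θ A) n
θ-^ A zero n = begin
  θ (one ⊛ A) n         ≡⟨ cong (fromℕ n *_) (one-⊛ A n) ⟩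
  θ A n                 ≡⟨ one-⊛ (θ A) n ⟨
  (one ⊛ θ A) n         ≡⟨ *-identityˡ ((one ⊛ θ A) n) ⟨
  1ℚ * (one ⊛ θ A) n    ∎
  where open ≡-Reasoning
θ-^ A (suc k) n = begin
  θ (A ^ suc k ⊛ A) n
    ≡⟨ θ-⊛ (A ^ suc k) A n ⟩
  (θ (A ^ suc k) ⊛ A) n + (A ^ suc k ⊛ θ A) n
    ≡⟨ cong (_+ (A ^ suc k ⊛ θ A) n) (begin
      (θ (A ^ suc k) ⊛ A) n
        ≡⟨ ⊛-cong {θ (A ^ suc k)} {λ i → fromℕ (suc k) * (A ^ k ⊛ θ A) i} {A} {A}
             (θ-^ A k) (λ _ → refl) n ⟩
      ((λ i → fromℕ (suc k) * (A ^ k ⊛ θ A) i) ⊛ A) n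
        ≡⟨ scale-⊛ (fromℕ (suc k)) (A ^ k ⊛ θ A) A n ⟩
      fromℕ (suc k) * ((A ^ k ⊛ θ A) ⊛ A) n
        ≡⟨ cong (fromℕ (suc k) *_)
             (solve 3 (λ x y z → x :* y :* z := x :* z :* y) (λ _ → refl) (A ^ k) (θ A) A n) ⟩
      fromℕ (suc k) * (A ^ suc k ⊛ θ A) n ∎) ⟩
  fromℕ (suc k) * x + x
    ≡⟨ cong (fromℕ (suc k) * x +_) (*-identityˡ x) ⟨
  fromℕ (suc k) * x + 1ℚ * x
    ≡⟨ *-distribʳ-+ x (fromℕ (suc k)) 1ℚ ⟨
  (fromℕ (suc k) + 1ℚ) * x
    ≡⟨ cong (_* x) (trans (+-comm (fromℕ (suc k)) 1ℚ) (sym (fromℕ-+ 1 (suc k)))) ⟩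
  fromℕ (suc (suc k)) * x ∎
  where
  open ≡-Reasoning
  open SeriesSolver
  x = (A ^ suc k ⊛ θ A) n

^-vanish : ∀ A → A 0 ≡ 0ℚ → ∀ k n → n < k → (A ^ k) n ≡ 0ℚ
-- With `A` in front, its vanishing constant term splits off by computation. The other terms contain
-- `A ^ k` only in degrees below `k`, where the induction hypothesis applies.
^-vanish A A0 (suc k) n (s≤s n≤k) = trans (⊛-comm (A ^ k) A n) (lemma n n≤k)
  where
  0*x+0 : ∀ {x y} z → x ≡ 0ℚ → y ≡ 0ℚ → x * z + y ≡ 0ℚ
  0*x+0 z refl refl = trans (+-identityʳ (0ℚ * z)) (*-zeroˡ z)
  lemma : ∀ n → n ≤ k → (A ⊛ A ^ k) n ≡ 0ℚ
  lemma zero    _   = 0*x+0 ((A ^ k) 0) A0 refl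
  lemma (suc n) n<k = 0*x+0 ((A ^ k) (suc n)) A0
    (trans (⊛-comm (tail A) (A ^ k) n)
           (⊛-vanishˡ (tail A) n (λ i i≤n → ^-vanish A A0 k i (ℕₚ.≤-<-trans i≤n n<k))))

sum-extend : ∀ {n N} (f : ℕ → ℚ) → (∀ k → n < k → f k ≡ 0ℚ) → n ≤ N →
             ∑[ k ≤ n ] f (toℕ k) ≡ ∑[ k ≤ N ] f (toℕ k)
sum-extend {N = N} f f≡0 z≤n = cong (f 0 +_) (sym (trans
  (sum-cong-≗ {N} (λ i → f≡0 (suc (toℕ i)) (s≤s z≤n))) (sum-replicate-zero N)))
sum-extend f f≡0 (s≤s n≤N) =
  cong (f 0 +_) (sum-extend (f ∘ suc) (λ k n<k → f≡0 (suc k) (s≤s n<k)) n≤N)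

-- F ⊚ A with the cut-off independent of the degree, so that it is linear over series.
truncated : ℕ → Series → (ℕ → Series) → Series
truncated N F G n = ∑[ k < N ] (F (toℕ k) * G (toℕ k) n)

truncated-⊛ : ∀ N F G H → truncated N F G ⊛ H ≗ truncated N F (λ k → G k ⊛ H)
truncated-⊛ zero    F G H n = ⊛-vanishˡ H n (λ _ _ → refl)
truncated-⊛ (suc N) F G H n = trans
  (⊛-distribʳ-⊕ H (λ i → F 0 * G 0 i) (truncated N (tail F) (G ∘ suc)) n)
  (cong₂ _+_ (scale-⊛ (F 0) (G 0) H n) (truncated-⊛ N (tail F) (G ∘ suc) H n))

⊚-truncated : ∀ F A → A 0 ≡ 0ℚ → ∀ {n N} → n ≤ N → (F ⊚ A) n ≡ truncated (suc N) F (A ^_) n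
⊚-truncated F A A0 {n} {N} n≤N = sum-extend (λ k → F k * (A ^ k) n)
  (λ k n<k → trans (cong (F k *_) (^-vanish A A0 k n n<k)) (*-zeroʳ (F k))) n≤N

⊚-cong : ∀ {F G} A → F ≗ G → F ⊚ A ≗ G ⊚ A
⊚-cong A F≗G n = sum-cong-≗ {suc n} (λ k → cong (_* (A ^ toℕ k) n) (F≗G (toℕ k)))

-- The sum is differentiated term by term: θ(A^(k+1)) = (k+1) A^k θA, where k+1 is absorbed into
-- `D F` and the common factor θA is pulled out.
chain-rule : ∀ F A → A 0 ≡ 0ℚ → θ (F ⊚ A) ≗ (D F ⊚ A) ⊛ θ A
chain-rule F A A0 n = begin
  fromℕ n * (F ⊚ A) n
    -- The cut-off is one higher than degree `n` demands: the term with k = 0 dies under θ, and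
    -- after the shift of index the terms k ≤ n of `D F` remain.
    ≡⟨ cong (fromℕ n *_) (⊚-truncated F A A0 (ℕₚ.n≤1+n n)) ⟩
  fromℕ n * truncated (suc (suc n)) F (A ^_) n
    ≡⟨ *-distribˡ-sum {suc (suc n)} (fromℕ n) (λ k → F (toℕ k) * (A ^ toℕ k) n) ⟩
  fromℕ n * (F 0 * one n) + ∑[ k ≤ n ] (fromℕ n * (F (suc (toℕ k)) * (A ^ suc (toℕ k)) n))
    ≡⟨ cong₂ _+_ (trans (x*yz (fromℕ n) (F 0) (one n))
                  (trans (cong (F 0 *_) (θ-one n)) (*-zeroʳ (F 0))))
         (sum-cong-≗ {suc n} (λ k → step (toℕ k))) ⟩
  0ℚ + truncated (suc n) (D F) (λ k → A ^ k ⊛ θ A) n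
    ≡⟨ +-identityˡ _ ⟩
  truncated (suc n) (D F) (λ k → A ^ k ⊛ θ A) n
    ≡⟨ truncated-⊛ (suc n) (D F) (A ^_) (θ A) n ⟨
  (truncated (suc n) (D F) (A ^_) ⊛ θ A) n
    -- In the product each coefficient of `D F ⊚ A` has its own cut-off `toℕ i`; all of them are
    -- raised to the common bound `n`.
    ≡⟨ sum-cong-≗ {suc n} (λ i → cong (_* θ A (n ∸ toℕ i)) (⊚-truncated (D F) A A0 (toℕ≤pred[n] i))) ⟨
  ((D F ⊚ A) ⊛ θ A) n ∎
  where
  open ≡-Reasoning
  x*yz : ∀ x y z → x * (y * z) ≡ y * (x * z)
  x*yz = let open +-*-Solver in solve 3 (λ x y z → x :* (y :* z) := y :* (x :* z)) refl
  θ-one : ∀ n → θ one n ≡ 0ℚ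
  θ-one zero    = refl
  θ-one (suc n) = *-zeroʳ (fromℕ (suc n))
  step : ∀ k → fromℕ n * (F (suc k) * (A ^ suc k) n) ≡ D F k * (A ^ k ⊛ θ A) n
  step k = trans (x*yz (fromℕ n) (F (suc k)) ((A ^ suc k) n))
    (trans (cong (F (suc k) *_) (θ-^ A k n))
    (trans (sym (*-assoc (F (suc k)) (fromℕ (suc k)) ((A ^ k ⊛ θ A) n)))
      (cong (_* (A ^ k ⊛ θ A) n) (*-comm (F (suc k)) (fromℕ (suc k))))))

-- Differential equations for arcsinh t and t / arcsinh t

t⊛-suc : ∀ F n → (t ⊛ F) (suc n) ≡ F n
t⊛-suc F n = trans (cong₂ _+_ (*-zeroˡ (F (suc n))) (one-⊛ F n)) (+-identityˡ (F n))

fromℕ-cancel : ∀ n {x y} → fromℕ (suc n) * x ≡ fromℕ (suc n) * y → x ≡ y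
fromℕ-cancel n {x} {y} eq = trans (sym (undo x)) (trans (cong (r *_) eq) (undo y))
  where
  r = ℤ.+ 1 / suc n
  undo : ∀ z → r * (fromℕ (suc n) * z) ≡ z
  undo z = trans (sym (*-assoc r (fromℕ (suc n)) z))
                 (trans (cong (_* z) (1/-inverse (suc n))) (*-identityˡ z))

-- The kernel of θ consists of the constants, since degree n is multiplied by n.
θ-injective : ∀ F G → F 0 ≡ G 0 → θ F ≗ θ G → F ≗ G
θ-injective F G F0≡G0 θF≗θG zero    = F0≡G0
θ-injective F G F0≡G0 θF≗θG (suc n) = fromℕ-cancel n (θF≗θG (suc n))

-- `D sinh` is the series of cosh; the second series is t / sqrt(1 + t²).
cosh∘arcsinh θarcsinh : Series
cosh∘arcsinh = D sinh ⊚ arcsinh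
θarcsinh     = θ arcsinh

cosh∘arcsinh-⊛-θarcsinh : cosh∘arcsinh ⊛ θarcsinh ≗ t
cosh∘arcsinh-⊛-θarcsinh n = begin
  (cosh∘arcsinh ⊛ θarcsinh) n ≡⟨ chain-rule sinh arcsinh refl n ⟨
  θ (sinh ⊚ arcsinh) n        ≡⟨ θ-cong sinh⊚arcsinh n ⟩
  θ t n                       ≡⟨ θ-t n ⟩
  t n                         ∎
  where open ≡-Reasoning

θ-cosh∘arcsinh : θ cosh∘arcsinh ≗ t ⊛ θarcsinh
θ-cosh∘arcsinh n = begin
  θ cosh∘arcsinh n                           ≡⟨ chain-rule (D sinh) arcsinh refl n ⟩
  ((D (D sinh) ⊚ arcsinh) ⊛ θarcsinh) n
    ≡⟨ ⊛-cong {D (D sinh) ⊚ arcsinh} {t} {θarcsinh} {θarcsinh}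
         (λ i → trans (⊚-cong arcsinh D-D-sinh i) (sinh⊚arcsinh i)) (λ _ → refl) n ⟩
  (t ⊛ θarcsinh) n                           ∎
  where open ≡-Reasoning

θ-t⊛t : θ (t ⊛ t) ≗ t ⊛ t ⊕ t ⊛ t
θ-t⊛t n = trans (θ-⊛ t t n) (cong₂ _+_ (⊛-cong {θ t} {t} {t} {t} θ-t (λ _ → refl) n)
                                      (⊛-cong {t} {t} {θ t} {t} (λ _ → refl) θ-t n))

-- No addition theorem is composed with arcsinh: both sides have constant term 1 and the same image
-- 2t² under θ.
cosh²∘arcsinh : cosh∘arcsinh ⊛ cosh∘arcsinh ≗ 1+t²
cosh²∘arcsinh = θ-injective (C ⊛ C) 1+t² refl θ-eq
  where
  open ≡-Reasoning
  C = cosh∘arcsinh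
  a = θarcsinh
  half : C ⊛ θ C ≗ t ⊛ t
  half n = begin
    (C ⊛ θ C) n      ≡⟨ ⊛-cong {C} {C} {θ C} {t ⊛ a} (λ _ → refl) θ-cosh∘arcsinh n ⟩
    (C ⊛ (t ⊛ a)) n  ≡⟨ solve 3 (λ x y z → x :* (y :* z) := y :* (x :* z)) (λ _ → refl) C t a n ⟩
    (t ⊛ (C ⊛ a)) n  ≡⟨ ⊛-cong {t} {t} {C ⊛ a} {t} (λ _ → refl) cosh∘arcsinh-⊛-θarcsinh n ⟩
    (t ⊛ t) n        ∎
    where open SeriesSolver
  θ-1+t² : θ 1+t² ≗ θ (t ⊛ t)
  θ-1+t² zero    = refl
  θ-1+t² (suc n) = cong (fromℕ (suc n) *_) (+-identityˡ ((t ⊛ t) (suc n)))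
  θ-eq : θ (C ⊛ C) ≗ θ 1+t²
  θ-eq n = begin
    θ (C ⊛ C) n                  ≡⟨ θ-⊛ C C n ⟩
    (θ C ⊛ C) n + (C ⊛ θ C) n    ≡⟨ cong₂ _+_ (trans (⊛-comm (θ C) C n) (half n)) (half n) ⟩
    (t ⊛ t) n + (t ⊛ t) n        ≡⟨ θ-t⊛t n ⟨
    θ (t ⊛ t) n                  ≡⟨ θ-1+t² n ⟨
    θ 1+t² n                     ∎

arcsinh-ode : 1+t² ⊛ θ θarcsinh ≗ θarcsinh
arcsinh-ode = ode C a (θ C) (θ a) cosh∘arcsinh-⊛-θarcsinh cosh²∘arcsinh θ-cosh∘arcsinh
  (λ n → trans (sym (θ-⊛ C a n)) (trans (θ-cong cosh∘arcsinh-⊛-θarcsinh n) (θ-t n)))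
  where
  C = cosh∘arcsinh
  a = θarcsinh

f u : Series
f = t/arcsinh
u = θ f ⊖ f

t⊛u : t ⊛ u ≗ ⊝ (f ⊛ f ⊛ θarcsinh)
t⊛u = quotient-ode₁ arcsinh θarcsinh f (θ f) arcsinh⊛t/arcsinh
  (λ n → trans (sym (θ-⊛ arcsinh f n)) (trans (θ-cong arcsinh⊛t/arcsinh n) (θ-t n)))

-- This is θ applied to `t⊛u`, with θf written as `u ⊕ f` so that the elimination involves only `f`,
-- `u` and `θ u`.
θ-t⊛u : t ⊛ u ⊕ t ⊛ θ u ≗ ⊝ (((u ⊕ f) ⊛ f ⊕ f ⊛ (u ⊕ f)) ⊛ θarcsinh ⊕ f ⊛ f ⊛ θ θarcsinh)
θ-t⊛u n = begin
  (t ⊛ u ⊕ t ⊛ θ u) n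
    ≡⟨ cong (_+ (t ⊛ θ u) n) (⊛-cong {θ t} {t} {u} {u} θ-t (λ _ → refl) n) ⟨
  (θ t ⊛ u ⊕ t ⊛ θ u) n       ≡⟨ θ-⊛ t u n ⟨
  θ (t ⊛ u) n                 ≡⟨ θ-cong t⊛u n ⟩
  fromℕ n * (- (f ⊛ f ⊛ a) n) ≡⟨ neg-distribʳ-* (fromℕ n) ((f ⊛ f ⊛ a) n) ⟨
  - θ (f ⊛ f ⊛ a) n           ≡⟨ cong -_ (θ-⊛ (f ⊛ f) a n) ⟩
  - ((θ (f ⊛ f) ⊛ a) n + (f ⊛ f ⊛ θ a) n)
    ≡⟨ cong (λ x → - (x + (f ⊛ f ⊛ θ a) n))
         (⊛-cong {θ (f ⊛ f)} {(u ⊕ f) ⊛ f ⊕ f ⊛ (u ⊕ f)} {a} {a} θ-f⊛f (λ _ → refl) n) ⟩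
  - ((((u ⊕ f) ⊛ f ⊕ f ⊛ (u ⊕ f)) ⊛ a) n + (f ⊛ f ⊛ θ a) n) ∎
  where
  open ≡-Reasoning
  a = θarcsinh
  θ-f : θ f ≗ u ⊕ f
  θ-f n = solve 2 (λ x y → x := x :- y :+ y) refl (θ f n) (f n)
    where open +-*-Solver
  θ-f⊛f : θ (f ⊛ f) ≗ (u ⊕ f) ⊛ f ⊕ f ⊛ (u ⊕ f)
  θ-f⊛f n = trans (θ-⊛ f f n)
    (cong₂ _+_ (⊛-cong {θ f} {u ⊕ f} {f} {f} θ-f (λ _ → refl) n)
               (⊛-cong {f} {f} {θ f} {u ⊕ f} (λ _ → refl) θ-f n))

-- As u = (θ - 1)f, the left side is (θ - 2)(θ - 1)f + t² (θ - 1)² f. The factor t² of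
-- `quotient-ode₂` is cancelled by reading that identity two degrees higher.
cube-ode : (θ u ⊖ u ⊖ u) ⊕ t ⊛ (t ⊛ (θ u ⊖ u)) ≗ f ⊛ (f ⊛ f) ⊕ f ⊛ (f ⊛ f)
cube-ode n = trans (sym (t²⊛-suc² L)) (trans
  (quotient-ode₂ cosh∘arcsinh θarcsinh (θ θarcsinh) f u (θ u)
    cosh∘arcsinh-⊛-θarcsinh cosh²∘arcsinh arcsinh-ode t⊛u θ-t⊛u (suc (suc n)))
  (t²⊛-suc² R))
  where
  t²⊛-suc² : ∀ F → (t ⊛ (t ⊛ F)) (suc (suc n)) ≡ F n
  t²⊛-suc² F = trans (t⊛-suc (t ⊛ F) (suc n)) (t⊛-suc F n)
  L = (θ u ⊖ u ⊖ u) ⊕ t ⊛ (t ⊛ (θ u ⊖ u))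
  R = f ⊛ (f ⊛ f) ⊕ f ⊛ (f ⊛ f)

-- On degree j a polynomial in θ acts as its value at j: (θ - 2)(θ - 1) gives m (m + 1) in degree m
-- + 2, and t² (θ - 1)² brings (m - 1)² up from degree m.
cube-coefficient : ∀ m → (f ⊛ (f ⊛ f)) (suc (suc m)) + (f ⊛ (f ⊛ f)) (suc (suc m)) ≡
  fromℕ (suc m) * fromℕ m * f (suc (suc m)) + (fromℕ m - 1ℚ) * (fromℕ m - 1ℚ) * f m
cube-coefficient m = begin
  (f ⊛ (f ⊛ f)) n + (f ⊛ (f ⊛ f)) n                 ≡⟨ cube-ode n ⟨
  (θ u n - u n - u n) + (t ⊛ (t ⊛ (θ u ⊖ u))) n
    ≡⟨ cong (θ u n - u n - u n +_) (trans (t⊛-suc (t ⊛ (θ u ⊖ u)) (suc m)) (t⊛-suc (θ u ⊖ u) m)) ⟩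
  (θ u n - u n - u n) + (θ u m - u m)
    ≡⟨ cong (λ x → (x * u′ x - u′ x - u′ x) + (θ u m - u m)) (fromℕ-+ 2 m) ⟩
  (x * u′ x - u′ x - u′ x) + (θ u m - u m)
    ≡⟨ solve 3 (λ k y z → let x = con (fromℕ 2) :+ k ; v = x :* y :- y ; w = k :* z :- z in
         (x :* v :- v :- v) :+ (k :* w :- w) :=
         (con 1ℚ :+ k) :* k :* y :+ (k :- con 1ℚ) :* (k :- con 1ℚ) :* z) refl (fromℕ m) (f n) (f m) ⟩
  (1ℚ + fromℕ m) * fromℕ m * f n + (fromℕ m - 1ℚ) * (fromℕ m - 1ℚ) * f m
    ≡⟨ cong (λ x → x * fromℕ m * f n + (fromℕ m - 1ℚ) * (fromℕ m - 1ℚ) * f m) (fromℕ-+ 1 m) ⟨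
  fromℕ (suc m) * fromℕ m * f n + (fromℕ m - 1ℚ) * (fromℕ m - 1ℚ) * f m ∎
  where
  open ≡-Reasoning
  open +-*-Solver
  n = suc (suc m)
  x = fromℕ 2 + fromℕ m
  u′ : ℚ → ℚ
  u′ x = x * f n - f n

-- Even series, and the convolution as a coefficient

-- Unlike `2 ℕ.* suc n`, `double (suc n)` reduces to two successors, so convolutions in even degree
-- unfold two terms at a time.
double : ℕ → ℕ
double zero    = zero
double (suc n) = suc (suc (double n))

double≡2* : ∀ n → double n ≡ 2 ℕ.* n
double≡2* zero    = refl
double≡2* (suc n) = trans (cong (2 ℕ.+_) (double≡2* n)) (sym (ℕₚ.*-suc 2 n))

Even : Series → Set
Even F = ∀ k → F (suc (double k)) ≡ 0ℚ

even : Series → Series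
even F = F ∘ double

-- Only even indices of `F` contribute, and in even degree they meet even indices of `G`. Both
-- series are then read as series in t².
even-⊛ : ∀ {F} G → Even F → even (F ⊛ G) ≗ even F ⊛ even G
even-⊛     G F-even zero    = refl
even-⊛ {F} G F-even (suc n) = cong (F 0 * G (suc (suc (double n))) +_) (begin
  F 1 * G (suc (double n)) + (tail (tail F) ⊛ G) (double n)
    ≡⟨ cong (λ x → x * G (suc (double n)) + (tail (tail F) ⊛ G) (double n)) (F-even 0) ⟩
  0ℚ * G (suc (double n)) + (tail (tail F) ⊛ G) (double n)
    ≡⟨ cong₂ _+_ (*-zeroˡ (G (suc (double n)))) (even-⊛ {tail (tail F)} G (F-even ∘ suc) n) ⟩
  0ℚ + (tail (even F) ⊛ even G) n
    ≡⟨ +-identityˡ _ ⟩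
  (tail (even F) ⊛ even G) n ∎)
  where open ≡-Reasoning

-- In odd degree the even indices of `F` meet odd indices of `G`, which are even indices of
-- `tail G`. Splitting off the last term, which has an odd index of `F`, reduces this to `even-⊛`.
odd-⊛ : ∀ {F} G → Even F → even (tail (F ⊛ G)) ≗ even F ⊛ even (tail G)
odd-⊛ {F} G F-even n = begin
  (F ⊛ G) (suc (double n))
    ≡⟨ ⊛-sucʳ F G (double n) ⟩
  (F ⊛ tail G) (double n) + F (suc (double n)) * G 0
    ≡⟨ cong₂ _+_ (even-⊛ {F} (tail G) F-even n) (trans (cong (_* G 0) (F-even n)) (*-zeroˡ (G 0))) ⟩
  (even F ⊛ even (tail G)) n + 0ℚ
    ≡⟨ +-identityʳ _ ⟩
  (even F ⊛ even (tail G)) n ∎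
  where open ≡-Reasoning

⊛-cancel-𝟎 : ∀ F G → F 0 ≡ 1ℚ → F ⊛ G ≗ 𝟎 → G ≗ 𝟎
⊛-cancel-𝟎 F G F0 F⊛G≗0 n = begin
  G n                          ≡⟨ one-⊛ G n ⟨
  (one ⊛ G) n                  ≡⟨ ⊛-cong {F ⊛ R} {one} {G} {G} (reciprocal-correct F F0) (λ _ → refl) n ⟨
  (F ⊛ R ⊛ G) n                ≡⟨ solve 3 (λ x y z → x :* y :* z := x :* z :* y) (λ _ → refl) F R G n ⟩
  (F ⊛ G ⊛ R) n                ≡⟨ ⊛-vanishˡ R n (λ i _ → F⊛G≗0 i) ⟩
  0ℚ                           ∎
  where
  open ≡-Reasoning
  open SeriesSolver
  R = reciprocal F

-- In degree m + 2 the equation (1 + t²) θa = a reads (m + 2) a_{m+2} + m a_m = a_{m+2}, so a_{m+2}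
-- is a multiple of a_m, and a_0 = 0.
θarcsinh-even : ∀ k → θarcsinh (double k) ≡ 0ℚ
θarcsinh-even zero    = refl
θarcsinh-even (suc k) = fromℕ-cancel m (begin
  fromℕ (suc m) * a n
    -- The zero summand is inserted to become `θ a m`, by the induction hypothesis.
    ≡⟨ solve 3 (λ x y z → x :* y := (con 1ℚ :+ x) :* y :+ z :* con 0ℚ :- y) refl
         (fromℕ (suc m)) (a n) (fromℕ m) ⟩
  (1ℚ + fromℕ (suc m)) * a n + fromℕ m * 0ℚ - a n
    ≡⟨ cong₂ (λ x y → x * a n + fromℕ m * y - a n) (fromℕ-+ 1 (suc m)) (θarcsinh-even k) ⟨
  θ a n + θ a m - a n
    ≡⟨ cong (_- a n) recurrence ⟩
  a n - a n
    ≡⟨ +-inverseʳ (a n) ⟩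
  0ℚ
    ≡⟨ *-zeroʳ (fromℕ (suc m)) ⟨
  fromℕ (suc m) * 0ℚ ∎)
  where
  open ≡-Reasoning
  open +-*-Solver
  m = double k
  n = suc (suc m)
  a = θarcsinh
  recurrence : θ a n + θ a m ≡ a n
  recurrence = begin
    θ a n + θ a m
      ≡⟨ cong (θ a n +_) (trans (t⊛-suc (t ⊛ θ a) (suc m)) (t⊛-suc (θ a) m)) ⟨
    (θ a ⊕ t ⊛ (t ⊛ θ a)) n
      ≡⟨ S.solve 2 (λ x t → x S.:+ t S.:* (t S.:* x) S.:= (S.con 1ℚ S.:+ t S.:* t) S.:* x)
           (λ _ → refl) (θ a) t n ⟩
    (1+t² ⊛ θ a) n                     ≡⟨ arcsinh-ode n ⟩
    a n                                ∎
    where module S = SeriesSolver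

tail-arcsinh-even : Even (tail arcsinh)
tail-arcsinh-even k = fromℕ-cancel (suc (double k))
  (trans (θarcsinh-even (suc k)) (sym (*-zeroʳ (fromℕ (double (suc k))))))

-- In (A / t) f = 1 the odd coefficients of the product vanish. Since A / t is even, they form the
-- product of its even part with the odd part of `f`, and the former can be cancelled as it starts
-- with 1.
f-even : Even f
f-even = ⊛-cancel-𝟎 (even (tail arcsinh)) (even (tail f)) refl (λ n →
  trans (sym (odd-⊛ {tail arcsinh} f tail-arcsinh-even n))
        (reciprocal-correct (tail arcsinh) refl (suc (double n))))

cube-even : even (f ⊛ (f ⊛ f)) ≗ even f ^ 3
cube-even n = begin
  (f ⊛ (f ⊛ f)) (double n)             ≡⟨ even-⊛ {f} (f ⊛ f) f-even n ⟩
  (even f ⊛ even (f ⊛ f)) n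
    ≡⟨ ⊛-cong {even f} {even f} {even (f ⊛ f)} {even f ⊛ even f} (λ _ → refl) (even-⊛ {f} f f-even) n ⟩
  (even f ⊛ (even f ⊛ even f)) n
    ≡⟨ ⊛-comm (even f) (even f ⊛ even f) n ⟩
  (even f ⊛ even f ⊛ even f) n
    ≡⟨ ⊛-cong {one ⊛ even f ⊛ even f} {even f ⊛ even f} {even f} {even f}
         (⊛-cong {one ⊛ even f} {even f} {even f} {even f} (one-⊛ (even f)) (λ _ → refl))
         (λ _ → refl) n ⟨
  (even f ^ 3) n ∎
  where open ≡-Reasoning

-- Sums over weak compositions as coefficients of powers

sumOver : ∀ {A : Set} → (A → ℚ) → List A → ℚ
sumOver g xs = List.foldr _+_ 0ℚ (List.map g xs)

sumOver-cong : ∀ {A : Set} {g h : A → ℚ} → g ≗ h → sumOver g ≗ sumOver h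
sumOver-cong g≗h xs = cong (List.foldr _+_ 0ℚ) (Listₚ.map-cong g≗h xs)

sumOver-++ : ∀ {A : Set} (g : A → ℚ) xs ys → sumOver g (xs ++ ys) ≡ sumOver g xs + sumOver g ys
sumOver-++ g []       ys = sym (+-identityˡ (sumOver g ys))
sumOver-++ g (x ∷ xs) ys = trans (cong (g x +_) (sumOver-++ g xs ys)) (sym (+-assoc (g x) _ _))

sumOver-concatMap : ∀ {A B : Set} (g : B → ℚ) (h : A → List B) xs →
                    sumOver g (List.concatMap h xs) ≡ sumOver (sumOver g ∘ h) xs
sumOver-concatMap g h []       = refl
sumOver-concatMap g h (x ∷ xs) = trans (sumOver-++ g (h x) (List.concatMap h xs))
  (cong (sumOver g (h x) +_) (sumOver-concatMap g h xs))

sumOver-map : ∀ {A B : Set} (g : B → ℚ) (h : A → B) xs → sumOver g (List.map h xs) ≡ sumOver (g ∘ h) xs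
sumOver-map g h xs = cong (List.foldr _+_ 0ℚ) (sym (Listₚ.map-∘ xs))

sumOver-scale : ∀ {A : Set} c (g : A → ℚ) xs → sumOver (λ x → c * g x) xs ≡ c * sumOver g xs
sumOver-scale c g []       = sym (*-zeroʳ c)
sumOver-scale c g (x ∷ xs) =
  trans (cong (c * g x +_) (sumOver-scale c g xs)) (sym (*-distribˡ-+ c (g x) (sumOver g xs)))

sumOver-applyUpTo : ∀ g (h : ℕ → ℕ) n → sumOver g (List.applyUpTo h n) ≡ ∑[ i < n ] g (h (toℕ i))
sumOver-applyUpTo g h zero    = refl
sumOver-applyUpTo g h (suc n) = cong (g (h 0) +_) (sumOver-applyUpTo g (h ∘ suc) n)

-- Induction on `k`: a first entry i contributes the factor `F i`, and the remaining entries sum to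
-- `(F ^ k) (n ∸ i)`. This builds the power from the left while `_^_` builds it from the right,
-- hence the final commutation.
sumOver-weakCompositions : ∀ F k n → sumOver (∏ ∘ Vec.map F) (weakCompositions k n) ≡ (F ^ k) n
sumOver-weakCompositions F zero    zero    = refl
sumOver-weakCompositions F zero    (suc n) = refl
sumOver-weakCompositions F (suc k) n = begin
  sumOver P (weakCompositions (suc k) n)
    ≡⟨ sumOver-concatMap P (λ i → List.map (i ∷_) (weakCompositions k (n ∸ i))) (List.upTo (suc n)) ⟩
  sumOver (λ i → sumOver P (List.map (i ∷_) (weakCompositions k (n ∸ i)))) (List.upTo (suc n))
    ≡⟨ sumOver-cong (λ i → trans (sumOver-map P (i ∷_) (weakCompositions k (n ∸ i)))
         (trans (sumOver-scale (F i) (∏ ∘ Vec.map F) (weakCompositions k (n ∸ i)))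
                (cong (F i *_) (sumOver-weakCompositions F k (n ∸ i))))) (List.upTo (suc n)) ⟩
  sumOver (λ i → F i * (F ^ k) (n ∸ i)) (List.upTo (suc n))
    ≡⟨ sumOver-applyUpTo (λ i → F i * (F ^ k) (n ∸ i)) (λ i → i) (suc n) ⟩
  (F ⊛ F ^ k) n
    ≡⟨ ⊛-comm F (F ^ k) n ⟩
  (F ^ suc k) n ∎
  where
  open ≡-Reasoning
  P : Vec ℕ (suc k) → ℚ
  P = ∏ ∘ Vec.map F

-- The added `0` is what `2 ℕ.* j` reduces to for j = 0.
normalized-ℭ : ∀ i → 1/ 2 ℕ.* i ! * ℭ (2 ℕ.* i ℕ.+ 0) ≡ even f i
normalized-ℭ i = begin
  1/ m ! * ℭ (m ℕ.+ 0)          ≡⟨ cong (λ x → 1/ m ! * ℭ x) (ℕₚ.+-identityʳ m) ⟩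
  1/ m ! * (fromℕ (m !) * f m)  ≡⟨ *-assoc (1/ m !) (fromℕ (m !)) (f m) ⟨
  1/ m ! * fromℕ (m !) * f m    ≡⟨ cong (_* f m) (1/!-inverse m) ⟩
  1ℚ * f m                      ≡⟨ *-identityˡ (f m) ⟩
  f m                           ≡⟨ cong f (double≡2* i) ⟨
  even f i                      ∎
  where
  open ≡-Reasoning
  m = 2 ℕ.* i

∏-normalized-ℭ : ∀ {k} (is : Vec ℕ k) →
  ∏ (Vec.map (λ i → 1/ (2 ℕ.* i) !) is)
    * ∏ (Vec.zipWith (λ i j → ℭ (2 ℕ.* i ℕ.+ 2 ℕ.* j)) is (Vec.replicate k 0))
  ≡ ∏ (Vec.map (even f) is)
∏-normalized-ℭ []       = refl
∏-normalized-ℭ (i ∷ is) = trans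
  (solve 4 (λ x y u v → x :* y :* (u :* v) := x :* u :* (y :* v)) refl
    (1/ 2 ℕ.* i !) _ (ℭ (2 ℕ.* i ℕ.+ 0)) _)
  (cong₂ _*_ (normalized-ℭ i) (∏-normalized-ℭ is))
  where open +-*-Solver

-- Each 1/(2i)! cancels the factorial in its Cauchy number, leaving ordinary coefficients of t /
-- arcsinh t as a series in t².
convolution-zeros : ∀ k n → convolution (Vec.replicate k 0) n ≡ fromℕ ((2 ℕ.* n) !) * (even f ^ k) n
convolution-zeros k n = begin
  convolution (Vec.replicate k 0) n
    ≡⟨ sumOver-cong (λ is → trans (*-assoc c (p is) (q is)) (cong (c *_) (∏-normalized-ℭ is)))
         (weakCompositions k n) ⟩
  sumOver (λ is → c * ∏ (Vec.map (even f) is)) (weakCompositions k n)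
    ≡⟨ sumOver-scale c (∏ ∘ Vec.map (even f)) (weakCompositions k n) ⟩
  c * sumOver (∏ ∘ Vec.map (even f)) (weakCompositions k n)
    ≡⟨ cong (c *_) (sumOver-weakCompositions (even f) k n) ⟩
  c * (even f ^ k) n ∎
  where
  open ≡-Reasoning
  c = fromℕ ((2 ℕ.* n) !)
  p q : Vec ℕ k → ℚ
  p is = ∏ (Vec.map (λ i → 1/ (2 ℕ.* i) !) is)
  q is = ∏ (Vec.zipWith (λ i j → ℭ (2 ℕ.* i ℕ.+ 2 ℕ.* j)) is (Vec.replicate k 0))

theorem5 : ∀ (n : ℕ) → n ≥ 1 →
    convolution (0 ∷ 0 ∷ 0 ∷ []) n
      ≡ (fromℕ 2 * fromℕ n - 1ℚ) * (fromℕ n - 1ℚ) * ℭ (2 ℕ.* n)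
        + fromℕ n * (fromℕ 2 * fromℕ n - 1ℚ)
          * ((fromℕ 2 * fromℕ n - fromℕ 3) * (fromℕ 2 * fromℕ n - fromℕ 3))
          * ℭ (2 ℕ.* n ∸ 2)
theorem5 n@(suc m) _ = begin
  convolution (0 ∷ 0 ∷ 0 ∷ []) n
    ≡⟨ convolution-zeros 3 n ⟩
  fromℕ ((2 ℕ.* n) !) * (even f ^ 3) n
    ≡⟨ cong₂ _*_ (trans (cong (λ i → fromℕ (i !)) (sym (double≡2* n))) factorial)
                  (sym (cube-even n)) ⟩
  two * x * (two * x - 1ℚ) * F * c
    -- The 2 in the factor 2n of (2n)! doubles the coefficient `c`, as `cube-coefficient` requires.
    ≡⟨ solve 3 (λ x F c → con (fromℕ 2) :* x :* (con (fromℕ 2) :* x :- con 1ℚ) :* F :* c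
                 := x :* (con (fromℕ 2) :* x :- con 1ℚ) :* F :* (c :+ c)) refl x F c ⟩
  x * (two * x - 1ℚ) * F * (c + c)
    ≡⟨ cong (x * (two * x - 1ℚ) * F *_) cube ⟩
  x * (two * x - 1ℚ) * F * ((two * x - 1ℚ) * (two * x - two) * f₁
                              + (two * x - fromℕ 3) * (two * x - fromℕ 3) * f₀)
    -- Writing 2n - 2 = 2 (n - 1) returns this 2, so that (2n)! is restored in front of `f₁`; in
    -- front of `f₀` the factor (2n - 2)! stays.
    ≡⟨ solve 4 (λ x F f₁ f₀ →
         let y = con (fromℕ 2) :* x ; y₁ = y :- con 1ℚ ; y₃ = y :- con (fromℕ 3) in
         x :* y₁ :* F :* (y₁ :* (y :- con (fromℕ 2)) :* f₁ :+ y₃ :* y₃ :* f₀)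
           := y₁ :* (x :- con 1ℚ) :* (y :* y₁ :* F :* f₁) :+ x :* y₁ :* (y₃ :* y₃) :* (F :* f₀))
         refl x F f₁ f₀ ⟩
  (two * x - 1ℚ) * (x - 1ℚ) * (two * x * (two * x - 1ℚ) * F * f₁)
    + x * (two * x - 1ℚ) * ((two * x - fromℕ 3) * (two * x - fromℕ 3)) * (F * f₀)
    ≡⟨ cong₂ (λ y z → (two * x - 1ℚ) * (x - 1ℚ) * y
               + x * (two * x - 1ℚ) * ((two * x - fromℕ 3) * (two * x - fromℕ 3)) * z)
         -- Both products are Cauchy numbers by definition, at `double n` and at `M`, the latter
         -- being `double n ∸ 2` by computation.
         (trans (cong (_* f₁) (sym factorial)) (cong ℭ (double≡2* n)))
         (cong (λ i → ℭ (i ∸ 2)) (double≡2* n)) ⟩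
  (two * x - 1ℚ) * (x - 1ℚ) * ℭ (2 ℕ.* n)
    + x * (two * x - 1ℚ) * ((two * x - fromℕ 3) * (two * x - fromℕ 3)) * ℭ (2 ℕ.* n ∸ 2) ∎
  where
  open ≡-Reasoning
  open +-*-Solver
  M = double m
  x = fromℕ n
  two = fromℕ 2
  F = fromℕ (M !)
  c = (f ⊛ (f ⊛ f)) (double n)
  f₁ = f (double n)
  f₀ = f M
  fromℕ-double : fromℕ (double n) ≡ two * x
  fromℕ-double = trans (cong fromℕ (double≡2* n)) (fromℕ-* 2 n)
  fromℕ-1+M : fromℕ (suc M) ≡ two * x - 1ℚ
  fromℕ-1+M = trans (solve 1 (λ y → y := con 1ℚ :+ y :- con 1ℚ) refl (fromℕ (suc M)))
                    (cong (_- 1ℚ) (trans (sym (fromℕ-+ 1 (suc M))) fromℕ-double))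
  fromℕ-M : fromℕ M ≡ two * x - two
  fromℕ-M = trans (solve 1 (λ y → y := con (fromℕ 2) :+ y :- con (fromℕ 2)) refl (fromℕ M))
                  (cong (_- two) (trans (sym (fromℕ-+ 2 M)) fromℕ-double))
  factorial : fromℕ (double n !) ≡ two * x * (two * x - 1ℚ) * F
  factorial = begin
    fromℕ (double n !)                      ≡⟨ !-suc (suc M) ⟩
    fromℕ (double n) * fromℕ (suc M !)
      ≡⟨ cong₂ _*_ fromℕ-double (trans (!-suc M) (cong (_* F) fromℕ-1+M)) ⟩
    two * x * ((two * x - 1ℚ) * F)        ≡⟨ *-assoc (two * x) (two * x - 1ℚ) F ⟨
    two * x * (two * x - 1ℚ) * F          ∎
  cube : c + c ≡ (two * x - 1ℚ) * (two * x - two) * f₁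
                 + (two * x - fromℕ 3) * (two * x - fromℕ 3) * f₀
  cube = begin
    c + c
      ≡⟨ cube-coefficient M ⟩
    fromℕ (suc M) * fromℕ M * f₁ + (fromℕ M - 1ℚ) * (fromℕ M - 1ℚ) * f₀
      ≡⟨ cong₂ (λ y z → y * z * f₁ + (z - 1ℚ) * (z - 1ℚ) * f₀) fromℕ-1+M fromℕ-M ⟩
    (two * x - 1ℚ) * (two * x - two) * f₁ + (two * x - two - 1ℚ) * (two * x - two - 1ℚ) * f₀
      ≡⟨ solve 3 (λ y f₁ f₀ → let z = y :- con (fromℕ 2) :- con 1ℚ ; w = y :- con (fromℕ 3)
                                  v = (y :- con 1ℚ) :* (y :- con (fromℕ 2)) :* f₁ in
           v :+ z :* z :* f₀ := v :+ w :* w :* f₀) refl (two * x) f₁ f₀ ⟩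
    (two * x - 1ℚ) * (two * x - two) * f₁ + (two * x - fromℕ 3) * (two * x - fromℕ 3) * f₀ ∎
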